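{- Let $G$ be a graph, let $d(G)$ be the number of dominating sets of $G$, and let $\mathrm{Con}(G)$ be the set of all vertex-induced conformal subgraphs of $G$. Then $$d(G)=\sum_{H\in\mathrm{Con}(G)}2^{k(H)},$$ where $k(H)$ denotes the number of components of $H$.
   Context: All graphs are finite, simple and undirected. For a graph $G=(V,E)$, the closed neighborhood $N_G[v]$ of a vertex $v$ is the set consisting of $v$ and all its neighbors, and $N_G[W]=\bigcup_{v\in W}N_G[v]$ for $W\subseteq V$. A set $W\subseteq V$ is dominating in $G$ if $N_G[W]=V$. For $W\subseteq V$, the vertex-induced subgraph $G[W]$ has vertex set $W$ and all edges of $G$ with both end vertices in $W$; distinct subsets $W$ give distinct vertex-induced subgraphs (subgraphs are not identified up to isomorphism). A graph is called conformal if all of its components are of even order (have an even number of vertices). The null graph $G[\emptyset]$ is conformal and has no components. -}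

module Defs where

open import Level using (0ℓ)
open import Data.Nat.Base using (ℕ; zero; suc)
open import Data.Nat.Divisibility using (_∣_; _∣?_)
open import Data.Empty using (⊥)
open import Data.Fin.Base using (Fin)
open import Data.Fin.Properties using (_≟_; any?; all?)
open import Data.Fin.Subset using (Subset; inside; outside; _∈_; _⊆_; _∩_; ∣_∣)
open import Data.Fin.Subset.Properties using (_∈?_; _⊆?_; x∈p∩q⁺; anySubset?)
open import Data.List.Base using (List; []; _∷_; _++_; map; filter; length; allFin)
import Data.List.Membership.Propositional as List
open import Data.List.Membership.Propositional.Properties
  using (∈-map⁺; ∈-map⁻; ∈-++⁺ˡ; ∈-++⁺ʳ; ∈-allFin)
open import Data.List.Relation.Unary.All using ([])
open import Data.List.Relation.Unary.AllPairs using ([]; _∷_)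
open import Data.List.Relation.Unary.Any using (here; there)
open import Data.List.Relation.Unary.Unique.Propositional using (Unique)
import Data.List.Relation.Unary.Unique.Propositional.Properties as Unique
open import Data.Product.Base using (∃; _×_; _,_; proj₁; proj₂)
open import Data.Sum.Base using (_⊎_; inj₁; inj₂; [_,_])
open import Data.Vec.Base using ([]; _∷_)
open import Data.Vec.Properties using (∷-injectiveʳ)
open import Function.Base using (id)
open import Relation.Binary.Construct.Closure.ReflexiveTransitive using (Star; ε; _◅_; _◅◅_)
open import Relation.Binary.Core using (Rel)
open import Relation.Binary.Definitions using (Decidable; Irreflexive; Symmetric)
open import Relation.Binary.PropositionalEquality using (_≡_; refl)
open import Relation.Nullary.Decidable
  using (Dec; map′; decidable-stable; ¬?; _×-dec_; _⊎-dec_; _→-dec_)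
import Relation.Unary as U
open import Relation.Unary using (Pred; _≐_)

-- The vertex set is a subset of Fin n rather than all of it, so that
-- a vertex-induced subgraph is again a graph without relabelling.

record Graph (n : ℕ) : Set₁ where
  infix 4 _~_ _~?_
  field
    V        : Subset n
    _~_      : Rel (Fin n) 0ℓ
    _~?_     : Decidable _~_
    ~-sym    : Symmetric _~_
    ~-irrefl : Irreflexive _≡_ _~_
    ~⇒∈V     : ∀ {u v} → u ~ v → u ∈ V

open Graph public using (V)

private
  variable
    n : ℕ

-- For W ⊆ V G, which is the only case used below, V (G [ W ]) is W.

infix 8 _[_]

_[_] : Graph n → Subset n → Graph n
G [ W ] = record
  { V        = V G ∩ W
  ; _~_      = λ u v → u ~ v × u ∈ W × v ∈ W
  ; _~?_     = λ u v → (u ~? v) ×-dec (u ∈? W) ×-dec (v ∈? W)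
  ; ~-sym    = λ (u~v , u∈W , v∈W) → ~-sym u~v , v∈W , u∈W
  ; ~-irrefl = λ u≡v (u~v , _) → ~-irrefl u≡v u~v
  ; ~⇒∈V     = λ (u~v , u∈W , _) → x∈p∩q⁺ (~⇒∈V u~v , u∈W)
  }
  where open Graph G using (_~_; _~?_; ~-sym; ~-irrefl; ~⇒∈V)

subsets : ∀ n → List (Subset n)
subsets zero    = [] ∷ []
subsets (suc n) = map (outside ∷_) (subsets n) ++ map (inside ∷_) (subsets n)

∈-subsets : (W : Subset n) → W List.∈ subsets n
∈-subsets []            = here refl
∈-subsets (outside ∷ W) = ∈-++⁺ˡ (∈-map⁺ (outside ∷_) (∈-subsets W))
∈-subsets (inside  ∷ W) = ∈-++⁺ʳ _ (∈-map⁺ (inside ∷_) (∈-subsets W))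

subsets-unique : ∀ n → Unique (subsets n)
subsets-unique zero    = [] ∷ []
subsets-unique (suc n) = Unique.++⁺
  (Unique.map⁺ ∷-injectiveʳ (subsets-unique n))
  (Unique.map⁺ ∷-injectiveʳ (subsets-unique n))
  λ (p , q) → disjoint (∈-map⁻ (outside ∷_) p) (∈-map⁻ (inside ∷_) q)
  where
  disjoint : ∀ {W : Subset (suc n)} {Us Us′ : List (Subset n)} →
             (∃ λ U → U List.∈ Us × W ≡ outside ∷ U) →
             (∃ λ U → U List.∈ Us′ × W ≡ inside ∷ U) → ⊥
  disjoint (_ , _ , refl) (_ , _ , ())

subsetsOf : Subset n → List (Subset n)
subsetsOf {n} S = filter (_⊆? S) (subsets n)

module _ (G : Graph n) where
  open Graph G using (_~_; _~?_)

  N[_] : Fin n → Pred (Fin n) 0ℓ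
  N[ v ] u = u ≡ v ⊎ v ~ u

  N[_]ₛ : Subset n → Pred (Fin n) 0ℓ
  N[ W ]ₛ u = ∃ λ v → v ∈ W × N[ v ] u

  Dominating : Pred (Subset n) 0ℓ
  Dominating W = N[ W ]ₛ ≐ (_∈ V G)

  N[_]ₛ? : ∀ W → U.Decidable N[ W ]ₛ
  N[ W ]ₛ? u = any? λ v → (v ∈? W) ×-dec ((u ≟ v) ⊎-dec (v ~? u))

  dominating? : U.Decidable Dominating
  dominating? W = map′
    (λ (f , g) → (λ {u} → f u) , (λ {u} → g u))
    (λ (f , g) → (λ u → f {u}) , (λ u → g {u}))
    (all? (λ u → N[ W ]ₛ? u →-dec (u ∈? V G))
      ×-dec all? (λ u → (u ∈? V G) →-dec N[ W ]ₛ? u))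

d : Graph n → ℕ
d G = length (filter (dominating? G) (subsetsOf (V G)))

module Reachability {_~_ : Rel (Fin n) 0ℓ} (_~?_ : Decidable _~_) where

  -- Existence of a walk all of whose intermediate vertices lie in the given list.

  Via : List (Fin n) → Rel (Fin n) 0ℓ
  Via []       u v = u ≡ v ⊎ u ~ v
  Via (x ∷ xs) u v = Via xs u v ⊎ (Via xs u x × Via xs x v)

  via? : ∀ xs → Decidable (Via xs)
  via? []       u v = (u ≟ v) ⊎-dec (u ~? v)
  via? (x ∷ xs) u v = via? xs u v ⊎-dec (via? xs u x ×-dec via? xs x v)

  via⁺ : ∀ xs {u v} → u ≡ v ⊎ u ~ v → Via xs u v
  via⁺ []       p = p
  via⁺ (x ∷ xs) p = inj₁ (via⁺ xs p)

  via-trans : ∀ {xs u x v} → x List.∈ xs → Via xs u x → Via xs x v → Via xs u v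
  via-trans (here refl) p q = inj₂ ([ id , proj₁ ] p , [ id , proj₂ ] q)
  via-trans (there x∈) (inj₁ p)       (inj₁ q)       = inj₁ (via-trans x∈ p q)
  via-trans (there x∈) (inj₁ p)       (inj₂ (q , r)) = inj₂ (via-trans x∈ p q , r)
  via-trans (there x∈) (inj₂ (p , q)) (inj₁ r)       = inj₂ (p , via-trans x∈ q r)
  via-trans (there x∈) (inj₂ (p , _)) (inj₂ (_ , r)) = inj₂ (p , r)

  via⇒star : ∀ xs {u v} → Via xs u v → Star _~_ u v
  via⇒star []       (inj₁ refl)    = ε
  via⇒star []       (inj₂ u~v)     = u~v ◅ ε
  via⇒star (x ∷ xs) (inj₁ p)       = via⇒star xs p
  via⇒star (x ∷ xs) (inj₂ (p , q)) = via⇒star xs p ◅◅ via⇒star xs q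

  star⇒via : ∀ {u v} → Star _~_ u v → Via (allFin n) u v
  star⇒via ε         = via⁺ (allFin n) (inj₁ refl)
  star⇒via (u~x ◅ p) =
    via-trans (∈-allFin _) (via⁺ (allFin n) (inj₂ u~x)) (star⇒via p)

  star? : Decidable (Star _~_)
  star? u v = map′ (via⇒star (allFin n)) star⇒via (via? (allFin n) u v)

module _ (H : Graph n) where
  open Graph H using (_~_; _~?_)
  open Reachability _~?_ using (star?)

  -- Components are identified with their vertex sets, the classes of
  -- the vertices of H under the relation of being joined by a walk.

  IsComponent : Pred (Subset n) 0ℓ
  IsComponent C = ∃ λ v → v ∈ V H × (_∈ C) ≐ Star _~_ v

  isComponent? : U.Decidable IsComponent
  isComponent? C = any? λ v → (v ∈? V H) ×-dec map′
    (λ (f , g) → (λ {u} → f u) , (λ {u} → g u))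
    (λ (f , g) → (λ u → f {u}) , (λ u → g {u}))
    (all? (λ u → (u ∈? C) →-dec star? v u)
      ×-dec all? (λ u → star? v u →-dec (u ∈? C)))

  k : ℕ
  k = length (filter isComponent? (subsets n))

  Conformal : Set
  Conformal = ∀ C → IsComponent C → 2 ∣ ∣ C ∣

  conformal? : Dec Conformal
  conformal? = map′
    (λ ¬∃ C c → decidable-stable (2 ∣? ∣ C ∣) λ odd → ¬∃ (C , c , odd))
    (λ conf (C , c , odd) → odd (conf C c))
    (¬? (anySubset? λ C → isComponent? C ×-dec ¬? (2 ∣? ∣ C ∣)))

-- Distinct W ⊆ V G give distinct entries, so Con G has no repetitions.

Con : Graph n → List (Graph n)
Con G = filter conformal? (map (G [_]) (subsetsOf (V G)))

{-# OPTIONS --safe #-}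
-- The proof is by inclusion–exclusion over ℤ. Write sgn U = (-1)^|U|. Since the sum of sgn U over
-- all U ⊆ S is 1 if S is empty and 0 otherwise, taking S = V ∖ N[W] shows that d(G) is the sum of
-- sgn U over the pairs (W , U) of vertex sets that are disjoint and have no edge between them.
-- Grouping these pairs by H = W ∪ U, which is the symmetric difference of W and U, they become the
-- pairs (H , U) with U a union of components of G[H], and the sum of sgn U over those U is the
-- product of 1 + (-1)^|C| over the components C of G[H]: it is 2^k(G[H]) if G[H] is conformal and
-- 0 otherwise.
module Submission where

open import Defs
open import Data.Bool.Base using (true; false; if_then_else_; _xor_)
open import Data.Bool.Properties using (not-involutive; xor-comm)
open import Data.Fin.Base using (Fin; zero; suc)
open import Data.Fin.Properties using (all?)
open import Data.Fin.Subset using (Subset; inside; outside; _∈_; _∉_; _⊆_; ⊥; ∣_∣)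
open import Data.Fin.Subset.Properties
  using (_∈?_; _⊆?_; ∉⊥; ⊥⊆; ∣⊥∣≡0; ⊆-antisym; Empty-unique; x∈p∩q⁺; p∩q⊆p; p∩q⊆q)
open import Data.Integer.Base using (ℤ; +_; 0ℤ; 1ℤ; -1ℤ; _+_; _*_) renaming (_^_ to _^ℤ_)
open import Data.Integer.Properties
  using (+-identityˡ; +-assoc; +-comm; *-identityˡ; *-identityʳ; *-zeroʳ; *-assoc; *-distribˡ-+;
         pos-+; pos-*; +-injective)
open import Data.Integer.Tactic.RingSolver using (solve-∀)
open import Data.List.Base using (List; []; _∷_; _++_; map; filter; length)
import Data.List.Membership.Propositional as List
open import Data.List.Membership.Propositional.Properties
  using (∈-map⁺; ∈-map⁻; ∈-++⁺ˡ; ∈-++⁺ʳ; ∈-++⁻; ∈-filter⁺; ∈-filter⁻)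
open import Data.List.Membership.Propositional.Properties.WithK using (unique∧set⇒bag)
open import Data.List.Relation.Binary.BagAndSetEquality using (∼bag⇒↭)
open import Data.List.Relation.Binary.Permutation.Propositional using (_↭_; refl; prep; swap; trans)
import Data.List.Relation.Unary.All as All
open import Data.List.Relation.Unary.All using (All; []; _∷_)
open import Data.List.Relation.Unary.All.Properties using (all-filter)
open import Data.List.Relation.Unary.AllPairs using ([]; _∷_)
open import Data.List.Relation.Unary.Any using (Any; here; there)
open import Data.List.Relation.Unary.Unique.Propositional using (Unique)
import Data.List.Relation.Unary.Unique.Propositional.Properties as Unique
open import Data.Nat.Base using (ℕ; zero; suc; _^_)
open import Data.Nat.Divisibility using (_∣_; _∣?_; ∣m∣n⇒∣m+n; ∣m+n∣m⇒∣n; ∣-refl)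
open import Data.Nat.ListAction using (sum)
open import Data.Product.Base using (∃; _×_; _,_; proj₁; proj₂)
open import Data.Sum.Base using (_⊎_; inj₁; inj₂)
open import Data.Vec.Base using ([]; _∷_; here; there; zipWith; tabulate)
open import Data.Vec.Properties
  using (zipWith-comm; lookup∘tabulate; []=⇒lookup; lookup⇒[]=)
open import Function.Base using (_∘_)
open import Function.Bundles using (mk⇔)
open import Level using (Level)
open import Relation.Binary.Construct.Closure.ReflexiveTransitive
  using (Star; ε; _◅_; _◅◅_; reverse)
open import Relation.Binary.PropositionalEquality
  using (_≡_; refl; sym; cong; cong₂; subst; module ≡-Reasoning) renaming (trans to ≡-trans)
open import Relation.Nullary.Decidable
  using (Dec; yes; no; does; ¬?; _×-dec_; _→-dec_; decidable-stable; dec-true)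
open import Relation.Nullary.Negation using (¬_; contradiction)

private
  variable
    a b : Level
    n : ℕ
    A : Set a
    B : Set b
    P Q : Set

-- Indicators of decidable propositions and integer sums over lists.

χ : Dec P → ℤ
χ p? = if does p? then 1ℤ else 0ℤ

χ-cong : (P → Q) → (Q → P) → (p? : Dec P) (q? : Dec Q) → χ p? ≡ χ q?
χ-cong f g (yes p) (yes q) = refl
χ-cong f g (yes p) (no ¬q) = contradiction (f p) ¬q
χ-cong f g (no ¬p) (yes q) = contradiction (g q) ¬p
χ-cong f g (no ¬p) (no ¬q) = refl

χ-× : (p? : Dec P) (q? : Dec Q) → χ (p? ×-dec q?) ≡ χ p? * χ q?
χ-× (yes p) (yes q) = refl
χ-× (yes p) (no ¬q) = refl
χ-× (no ¬p) (yes q) = refl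
χ-× (no ¬p) (no ¬q) = refl

-- Where `P` fails both products vanish, so the two factors are compared only under `P`. This lets
-- an identity valid only for `W ⊆ V G` be applied inside a sum over all subsets.
χ-*-congˡ : (p? : Dec P) {x y : ℤ} → (P → x ≡ y) → χ p? * x ≡ χ p? * y
χ-*-congˡ (yes p) x≡y = cong (1ℤ *_) (x≡y p)
χ-*-congˡ (no ¬p) x≡y = refl

∑ : List A → (A → ℤ) → ℤ
∑ []       f = 0ℤ
∑ (x ∷ xs) f = f x + ∑ xs f

∑-cong : (xs : List A) {f g : A → ℤ} → (∀ x → f x ≡ g x) → ∑ xs f ≡ ∑ xs g
∑-cong []       f≗g = refl
∑-cong (x ∷ xs) f≗g = cong₂ _+_ (f≗g x) (∑-cong xs f≗g)

∑-0 : (xs : List A) → ∑ xs (λ _ → 0ℤ) ≡ 0ℤ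
∑-0 []       = refl
∑-0 (x ∷ xs) = ≡-trans (+-identityˡ _) (∑-0 xs)

∑-+ : (xs : List A) (f g : A → ℤ) → ∑ xs (λ x → f x + g x) ≡ ∑ xs f + ∑ xs g
∑-+ []       f g = refl
∑-+ (x ∷ xs) f g =
  ≡-trans (cong (_+_ (f x + g x)) (∑-+ xs f g)) (interchange (f x) (g x) (∑ xs f) (∑ xs g))
  where
  interchange : ∀ a b c d → a + b + (c + d) ≡ a + c + (b + d)
  interchange = solve-∀

*-∑ : (c : ℤ) (xs : List A) (f : A → ℤ) → c * ∑ xs f ≡ ∑ xs (λ x → c * f x)
*-∑ c []       f = *-zeroʳ c
*-∑ c (x ∷ xs) f = ≡-trans (*-distribˡ-+ c _ _) (cong (_+_ (c * f x)) (*-∑ c xs f))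

-- Merges an outer condition with an inner one, turning a nested conditional sum into a plain double
-- sum whose order can be exchanged; read backwards, it separates the two conditions again.
χ-*-∑ : (p? : Dec P) {Q : A → Set} (q? : ∀ x → Dec (Q x)) (xs : List A) (f : A → ℤ) →
        χ p? * ∑ xs (λ x → χ (q? x) * f x) ≡ ∑ xs (λ x → χ (p? ×-dec q? x) * f x)
χ-*-∑ p? q? xs f = ≡-trans (*-∑ (χ p?) xs _) (∑-cong xs λ x →
  ≡-trans (sym (*-assoc (χ p?) (χ (q? x)) (f x))) (cong (_* f x) (sym (χ-× p? (q? x)))))

∑-swap : (xs : List A) (ys : List B) (f : A → B → ℤ) →
         ∑ xs (λ x → ∑ ys (f x)) ≡ ∑ ys (λ y → ∑ xs (λ x → f x y))
∑-swap []       ys f = sym (∑-0 ys)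
∑-swap (x ∷ xs) ys f =
  ≡-trans (cong (_+_ (∑ ys (f x))) (∑-swap xs ys f)) (sym (∑-+ ys (f x) _))

∑-map : (g : A → B) (xs : List A) (f : B → ℤ) → ∑ (map g xs) f ≡ ∑ xs (f ∘ g)
∑-map g []       f = refl
∑-map g (x ∷ xs) f = cong (_+_ (f (g x))) (∑-map g xs f)

∑-++ : (xs ys : List A) (f : A → ℤ) → ∑ (xs ++ ys) f ≡ ∑ xs f + ∑ ys f
∑-++ []       ys f = sym (+-identityˡ _)
∑-++ (x ∷ xs) ys f = ≡-trans (cong (_+_ (f x)) (∑-++ xs ys f)) (sym (+-assoc (f x) _ _))

∑-filter : {P : A → Set} (P? : ∀ x → Dec (P x)) (xs : List A) (f : A → ℤ) →
           ∑ (filter P? xs) f ≡ ∑ xs (λ x → χ (P? x) * f x)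
∑-filter P? []       f = refl
∑-filter P? (x ∷ xs) f with does (P? x)
... | true  = cong₂ _+_ (sym (*-identityˡ (f x))) (∑-filter P? xs f)
... | false = ≡-trans (∑-filter P? xs f) (sym (+-identityˡ _))

∑-↭ : {xs ys : List A} (f : A → ℤ) → xs ↭ ys → ∑ xs f ≡ ∑ ys f
∑-↭ f refl         = refl
∑-↭ f (prep x p)   = cong (_+_ (f x)) (∑-↭ f p)
∑-↭ f (swap x y p) =
  ≡-trans (cong (λ s → f x + (f y + s)) (∑-↭ f p)) (exchange (f x) (f y) _)
  where
  exchange : ∀ a b c → a + (b + c) ≡ b + (a + c)
  exchange = solve-∀
∑-↭ f (trans p q)  = ≡-trans (∑-↭ f p) (∑-↭ f q)

pos-length : (xs : List A) → + length xs ≡ ∑ xs (λ _ → 1ℤ)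
pos-length []       = refl
pos-length (x ∷ xs) = cong (_+_ 1ℤ) (pos-length xs)

pos-sum : (f : A → ℕ) (xs : List A) → + sum (map f xs) ≡ ∑ xs (λ x → + f x)
pos-sum f []       = refl
pos-sum f (x ∷ xs) = ≡-trans (pos-+ (f x) _) (cong (_+_ (+ f x)) (pos-sum f xs))

∑-subsets-suc : (f : Subset (suc n) → ℤ) →
  ∑ (subsets (suc n)) f ≡ ∑ (subsets n) (f ∘ (outside ∷_)) + ∑ (subsets n) (f ∘ (inside ∷_))
∑-subsets-suc {n} f = ≡-trans
  (∑-++ (map (outside ∷_) (subsets n)) _ f)
  (cong₂ _+_ (∑-map (outside ∷_) (subsets n) f) (∑-map (inside ∷_) (subsets n) f))

-- Symmetric difference of subsets.

infixr 6 _△_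

_△_ : Subset n → Subset n → Subset n
_△_ = zipWith _xor_

△-comm : (S T : Subset n) → S △ T ≡ T △ S
△-comm = zipWith-comm xor-comm

△-cancelˡ : (S T : Subset n) → S △ (S △ T) ≡ T
△-cancelˡ []            []      = refl
△-cancelˡ (outside ∷ S) (t ∷ T) = cong (t ∷_) (△-cancelˡ S T)
△-cancelˡ (inside  ∷ S) (t ∷ T) = cong₂ _∷_ (not-involutive t) (△-cancelˡ S T)

x∈S△T⁺ˡ : {S T : Subset n} {x : Fin n} → x ∈ S → x ∉ T → x ∈ S △ T
x∈S△T⁺ˡ {T = outside ∷ T} here        x∉T = here
x∈S△T⁺ˡ {T = inside  ∷ T} here        x∉T = contradiction here x∉T
x∈S△T⁺ˡ {T = _ ∷ T}       (there x∈S) x∉T = there (x∈S△T⁺ˡ x∈S (x∉T ∘ there))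

x∈S△T⁺ʳ : {S T : Subset n} {x : Fin n} → x ∉ S → x ∈ T → x ∈ S △ T
x∈S△T⁺ʳ {S = S} {T} x∉S x∈T = subst (_ ∈_) (△-comm T S) (x∈S△T⁺ˡ x∈T x∉S)

x∈S△T⁻ : (S T : Subset n) {x : Fin n} → x ∈ S △ T → (x ∈ S × x ∉ T) ⊎ (x ∉ S × x ∈ T)
x∈S△T⁻ (inside  ∷ S) (outside ∷ T) here = inj₁ (here , λ ())
x∈S△T⁻ (outside ∷ S) (inside  ∷ T) here = inj₂ ((λ ()) , here)
x∈S△T⁻ (s ∷ S)       (t ∷ T)       (there x∈) with x∈S△T⁻ S T x∈
... | inj₁ (x∈S , x∉T) = inj₁ (there x∈S , λ { (there x∈T) → x∉T x∈T })
... | inj₂ (x∉S , x∈T) = inj₂ ((λ { (there x∈S) → x∉S x∈S }) , there x∈T)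

-- `_△ U` is a bijection on subsets, so it only reorders the sum. Coordinate by coordinate, an
-- `outside` head of `U` keeps the two halves of `subsets (suc n)` in place and an `inside` head
-- interchanges them.
∑-△ : (U : Subset n) (f : Subset n → ℤ) → ∑ (subsets n) (f ∘ (_△ U)) ≡ ∑ (subsets n) f
∑-△ []                      f = refl
∑-△ {suc n} (outside ∷ U) f = begin
  ∑ (subsets (suc n)) (f ∘ (_△ (outside ∷ U)))
    ≡⟨ ∑-subsets-suc (f ∘ (_△ (outside ∷ U))) ⟩
  ∑ (subsets n) (f ∘ (outside ∷_) ∘ (_△ U)) + ∑ (subsets n) (f ∘ (inside ∷_) ∘ (_△ U))
    ≡⟨ cong₂ _+_ (∑-△ U (f ∘ (outside ∷_))) (∑-△ U (f ∘ (inside ∷_))) ⟩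
  ∑ (subsets n) (f ∘ (outside ∷_)) + ∑ (subsets n) (f ∘ (inside ∷_))
    ≡⟨ ∑-subsets-suc f ⟨
  ∑ (subsets (suc n)) f ∎
  where open ≡-Reasoning
∑-△ {suc n} (inside ∷ U) f = begin
  ∑ (subsets (suc n)) (f ∘ (_△ (inside ∷ U)))
    ≡⟨ ∑-subsets-suc (f ∘ (_△ (inside ∷ U))) ⟩
  ∑ (subsets n) (f ∘ (inside ∷_) ∘ (_△ U)) + ∑ (subsets n) (f ∘ (outside ∷_) ∘ (_△ U))
    ≡⟨ cong₂ _+_ (∑-△ U (f ∘ (inside ∷_))) (∑-△ U (f ∘ (outside ∷_))) ⟩
  ∑ (subsets n) (f ∘ (inside ∷_)) + ∑ (subsets n) (f ∘ (outside ∷_))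
    ≡⟨ +-comm (∑ (subsets n) (f ∘ (inside ∷_))) _ ⟩
  ∑ (subsets n) (f ∘ (outside ∷_)) + ∑ (subsets n) (f ∘ (inside ∷_))
    ≡⟨ ∑-subsets-suc f ⟨
  ∑ (subsets (suc n)) f ∎
  where open ≡-Reasoning

-- Signs of subsets.

sgn : Subset n → ℤ
sgn U = -1ℤ ^ℤ ∣ U ∣

-1*-1* : ∀ i → -1ℤ * (-1ℤ * i) ≡ i
-1*-1* = solve-∀

-- The sizes satisfy |S △ T| = |S| + |T| - 2 |S ∩ T|, so the common elements do not affect the
-- parity.
sgn-△ : (S T : Subset n) → sgn (S △ T) ≡ sgn S * sgn T
sgn-△ []            []            = refl
sgn-△ (outside ∷ S) (outside ∷ T) = sgn-△ S T
sgn-△ (outside ∷ S) (inside  ∷ T) =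
  ≡-trans (cong (-1ℤ *_) (sgn-△ S T)) (shuffle (sgn S) (sgn T))
  where
  shuffle : ∀ a b → -1ℤ * (a * b) ≡ a * (-1ℤ * b)
  shuffle = solve-∀
sgn-△ (inside  ∷ S) (outside ∷ T) =
  ≡-trans (cong (-1ℤ *_) (sgn-△ S T)) (sym (*-assoc -1ℤ (sgn S) (sgn T)))
sgn-△ (inside  ∷ S) (inside  ∷ T) =
  ≡-trans (sgn-△ S T) (shuffle (sgn S) (sgn T))
  where
  shuffle : ∀ a b → a * b ≡ -1ℤ * a * (-1ℤ * b)
  shuffle = solve-∀

-- The factor contributed by a component of size `m`. Both sides have period two in `m`, hence the
-- recursion in steps of two.
1+[-1]^ : ∀ m → 1ℤ + -1ℤ ^ℤ m ≡ + 2 * χ (2 ∣? m)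
1+[-1]^ zero          = refl
1+[-1]^ (suc zero)    = refl
1+[-1]^ (suc (suc m)) = begin
  1ℤ + -1ℤ * (-1ℤ * -1ℤ ^ℤ m) ≡⟨ cong (_+_ 1ℤ) (-1*-1* (-1ℤ ^ℤ m)) ⟩
  1ℤ + -1ℤ ^ℤ m               ≡⟨ 1+[-1]^ m ⟩
  + 2 * χ (2 ∣? m)            ≡⟨ cong (+ 2 *_) (χ-cong (∣m∣n⇒∣m+n ∣-refl) (λ d → ∣m+n∣m⇒∣n d ∣-refl)
                                     (2 ∣? m) (2 ∣? suc (suc m))) ⟩
  + 2 * χ (2 ∣? suc (suc m))  ∎
  where open ≡-Reasoning

-- The alternating sum over the subsets of a decidable set.

Within : (Fin n → Set) → Subset n → Set
Within Q U = ∀ x → x ∈ U → Q x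

within? : {Q : Fin n → Set} → (∀ x → Dec (Q x)) → ∀ U → Dec (Within Q U)
within? Q? U = all? λ x → (x ∈? U) →-dec Q? x

-- If some element satisfies `Q`, toggling it pairs the admissible sets with opposite signs;
-- otherwise only the empty set remains and contributes 1. The induction decides this one element at
-- a time.
∑-within-sgn : {Q : Fin n → Set} (Q? : ∀ x → Dec (Q x)) →
  ∑ (subsets n) (λ U → χ (within? Q? U) * sgn U) ≡ χ (all? (¬? ∘ Q?))
∑-within-sgn {zero}  Q? = refl
∑-within-sgn {suc n} {Q} Q? = begin
  ∑ (subsets (suc n)) (λ U → χ (within? Q? U) * sgn U)
    ≡⟨ ∑-subsets-suc (λ U → χ (within? Q? U) * sgn U) ⟩
  ∑ (subsets n) (λ U → χ (within? Q? (outside ∷ U)) * sgn U) +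
  ∑ (subsets n) (λ U → χ (within? Q? (inside ∷ U)) * (-1ℤ * sgn U))
    ≡⟨ cong₂ _+_
         (∑-cong (subsets n) λ U → cong (_* sgn U)
           (χ-cong (λ w x → w (suc x) ∘ there) out⁺ (within? Q? (outside ∷ U)) (within? Q⁺? U)))
         (∑-cong (subsets n) λ U → ≡-trans
           (cong (_* (-1ℤ * sgn U)) (≡-trans
             (χ-cong (λ w → w zero here , λ x → w (suc x) ∘ there) in⁺
               (within? Q? (inside ∷ U)) (Q? zero ×-dec within? Q⁺? U))
             (χ-× (Q? zero) (within? Q⁺? U))))
           (shuffle (χ (Q? zero)) (χ (within? Q⁺? U)) (sgn U))) ⟩
  -- Putting `zero` into `U` requires `Q zero` and flips the sign, so the second half of the sum is
  -- `-1ℤ * χ (Q? zero)` times the first: the halves cancel if `Q zero` holds, and the second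
  -- vanishes if not.
  S + ∑ (subsets n) (λ U → (-1ℤ * χ (Q? zero)) * (χ (within? Q⁺? U) * sgn U))
    ≡⟨ cong (_+_ S) (*-∑ (-1ℤ * χ (Q? zero)) (subsets n) _) ⟨
  S + -1ℤ * χ (Q? zero) * S
    ≡⟨ cong (λ s → s + -1ℤ * χ (Q? zero) * s) (∑-within-sgn Q⁺?) ⟩
  χ none⁺? + -1ℤ * χ (Q? zero) * χ none⁺?
    ≡⟨ factor (Q? zero) ⟩
  χ (¬? (Q? zero)) * χ none⁺?
    ≡⟨ χ-× (¬? (Q? zero)) none⁺? ⟨
  χ (¬? (Q? zero) ×-dec none⁺?)
    ≡⟨ χ-cong none⁺ (λ none → none zero , none ∘ suc)
         (¬? (Q? zero) ×-dec none⁺?) (all? (¬? ∘ Q?)) ⟩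
  χ (all? (¬? ∘ Q?)) ∎
  where
  open ≡-Reasoning
  Q⁺? = Q? ∘ suc
  none⁺? = all? (¬? ∘ Q⁺?)
  S = ∑ (subsets n) (λ U → χ (within? Q⁺? U) * sgn U)
  out⁺ : ∀ {U} → Within (Q ∘ suc) U → Within Q (outside ∷ U)
  out⁺ w (suc x) (there x∈U) = w x x∈U
  in⁺ : ∀ {U} → Q zero × Within (Q ∘ suc) U → Within Q (inside ∷ U)
  in⁺ (q , w) zero    here        = q
  in⁺ (q , w) (suc x) (there x∈U) = w x x∈U
  none⁺ : ¬ Q zero × (∀ x → ¬ Q (suc x)) → ∀ x → ¬ Q x
  none⁺ (¬q , ¬qs) zero    = ¬q
  none⁺ (¬q , ¬qs) (suc x) = ¬qs x
  shuffle : ∀ a b c → a * b * (-1ℤ * c) ≡ -1ℤ * a * (b * c)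
  shuffle = solve-∀
  factor : (q? : Dec (Q zero)) →
           χ none⁺? + -1ℤ * χ q? * χ none⁺? ≡ χ (¬? q?) * χ none⁺?
  factor (yes q) = cancel (χ none⁺?)
    where
    cancel : ∀ a → a + -1ℤ * 1ℤ * a ≡ 0ℤ * a
    cancel = solve-∀
  factor (no ¬q) = cancel (χ none⁺?)
    where
    cancel : ∀ a → a + -1ℤ * 0ℤ * a ≡ 1ℤ * a
    cancel = solve-∀

-- Unions of sublists of a list of sets.

unions : List (Subset n) → List (Subset n)
unions []       = ⊥ ∷ []
-- For pairwise disjoint sets, such as distinct components, `C △_` adjoins `C` as a union would.
-- Symmetric difference has the advantage that `C △_` is its own inverse and that `sgn` is
-- multiplicative over it.
unions (C ∷ Cs) = unions Cs ++ map (C △_) (unions Cs)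

∉-unions : {x : Fin n} {Cs : List (Subset n)} → All (x ∉_) Cs → ∀ {U} → U List.∈ unions Cs → x ∉ U
∉-unions [] (here refl) = ∉⊥
∉-unions {Cs = C ∷ Cs} (x∉C ∷ x∉Cs) U∈ x∈U with ∈-++⁻ (unions Cs) U∈
... | inj₁ U∈′ = ∉-unions x∉Cs U∈′ x∈U
... | inj₂ U∈′ with ∈-map⁻ (C △_) U∈′
...   | T , T∈ , refl with x∈S△T⁻ C T x∈U
...     | inj₁ (x∈C , _) = x∉C x∈C
...     | inj₂ (_ , x∈T) = ∉-unions x∉Cs T∈ x∈T

-- Adjoining `C` multiplies the sum by `1ℤ + sgn C`, by `sgn-△`. The sum is therefore a product of
-- factors, each 2 for an even set and 0 for an odd one.
∑-unions-sgn : (Cs : List (Subset n)) →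
  ∑ (unions Cs) sgn ≡ χ (All.all? (λ C → 2 ∣? ∣ C ∣) Cs) * + (2 ^ length Cs)
∑-unions-sgn {n} []   = cong (λ m → -1ℤ ^ℤ m + 0ℤ) (∣⊥∣≡0 n)
∑-unions-sgn (C ∷ Cs) = begin
  ∑ (unions Cs ++ map (C △_) (unions Cs)) sgn
    ≡⟨ ∑-++ (unions Cs) _ sgn ⟩
  S + ∑ (map (C △_) (unions Cs)) sgn
    ≡⟨ cong (_+_ S) (∑-map (C △_) (unions Cs) sgn) ⟩
  S + ∑ (unions Cs) (λ T → sgn (C △ T))
    ≡⟨ cong (_+_ S) (∑-cong (unions Cs) (sgn-△ C)) ⟩
  S + ∑ (unions Cs) (λ T → sgn C * sgn T)
    ≡⟨ cong (_+_ S) (*-∑ (sgn C) (unions Cs) sgn) ⟨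
  S + sgn C * S
    ≡⟨ factor S (sgn C) ⟩
  (1ℤ + sgn C) * S
    ≡⟨ cong₂ _*_ (1+[-1]^ ∣ C ∣) (∑-unions-sgn Cs) ⟩
  + 2 * χ even? * (χ evens? * + (2 ^ length Cs))
    ≡⟨ regroup (+ 2) (χ even?) (χ evens?) _ ⟩
  χ even? * χ evens? * (+ 2 * + (2 ^ length Cs))
    ≡⟨ cong₂ _*_ (χ-× even? evens?) (pos-* 2 (2 ^ length Cs)) ⟨
  χ (even? ×-dec evens?) * + (2 ^ length (C ∷ Cs))
    ≡⟨ cong (_* + (2 ^ length (C ∷ Cs)))
         (χ-cong (λ (e , es) → e ∷ es) All.uncons
           (even? ×-dec evens?) (All.all? (λ C → 2 ∣? ∣ C ∣) (C ∷ Cs))) ⟩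
  χ (All.all? (λ C → 2 ∣? ∣ C ∣) (C ∷ Cs)) * + (2 ^ length (C ∷ Cs)) ∎
  where
  open ≡-Reasoning
  S = ∑ (unions Cs) sgn
  even? = 2 ∣? ∣ C ∣
  evens? = All.all? (λ C → 2 ∣? ∣ C ∣) Cs
  factor : ∀ a b → a + b * a ≡ (1ℤ + b) * a
  factor = solve-∀
  regroup : ∀ a b c d → a * b * (c * d) ≡ b * c * (a * d)
  regroup = solve-∀

-- Components and the vertex sets closed under adjacency.

module Components (K : Graph n) where
  open Graph K using (_~_; _~?_; ~-sym; ~⇒∈V)
  open Reachability _~?_ using (star?)

  star-sym : ∀ {u v} → Star _~_ u v → Star _~_ v u
  star-sym = reverse ~-sym

  -- A local description of the unions of components, which can be compared edge by edge with the
  -- absence of edges between two sets.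
  Saturated : Subset n → Set
  Saturated U = U ⊆ V K × (∀ x y → x ~ y → x ∈ U → y ∈ U)

  saturated? : ∀ U → Dec (Saturated U)
  saturated? U = (U ⊆? V K) ×-dec
    all? λ x → all? λ y → (x ~? y) →-dec (x ∈? U) →-dec (y ∈? U)

  saturated-star : ∀ {U u v} → Saturated U → Star _~_ u v → u ∈ U → v ∈ U
  saturated-star sat             ε         u∈U = u∈U
  saturated-star sat@(_ , closed) (e ◅ es) u∈U = saturated-star sat es (closed _ _ e u∈U)

  saturated-⊥ : Saturated ⊥
  saturated-⊥ = ⊥⊆ , λ _ _ _ x∈⊥ → contradiction x∈⊥ ∉⊥

  -- Adjacency is symmetric, so a closed set also has a closed complement: membership in `S` and in
  -- `T` is constant along each edge, and hence so is membership in `S △ T`.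
  saturated-△ : ∀ {S T} → Saturated S → Saturated T → Saturated (S △ T)
  saturated-△ {S} {T} (S⊆V , S-closed) (T⊆V , T-closed) = △⊆V , closed
    where
    △⊆V : S △ T ⊆ V K
    △⊆V x∈ with x∈S△T⁻ S T x∈
    ... | inj₁ (x∈S , _) = S⊆V x∈S
    ... | inj₂ (_ , x∈T) = T⊆V x∈T
    closed : ∀ x y → x ~ y → x ∈ S △ T → y ∈ S △ T
    closed x y x~y x∈ with x∈S△T⁻ S T x∈
    ... | inj₁ (x∈S , x∉T) = x∈S△T⁺ˡ (S-closed x y x~y x∈S) (x∉T ∘ T-closed y x (~-sym x~y))
    ... | inj₂ (x∉S , x∈T) = x∈S△T⁺ʳ (x∉S ∘ S-closed y x (~-sym x~y)) (T-closed x y x~y x∈T)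

  -- `V K` is itself saturated, because both ends of an edge are vertices.
  star-∈V : ∀ {u v} → Star _~_ u v → u ∈ V K → v ∈ V K
  star-∈V = saturated-star ((λ x∈V → x∈V) , λ x y x~y _ → ~⇒∈V (~-sym x~y))

  saturated-component : ∀ {C} → IsComponent K C → Saturated C
  saturated-component (v , v∈V , C⇒v⋆ , v⋆⇒C) =
    (λ x∈C → star-∈V (C⇒v⋆ x∈C) v∈V) ,
    λ x y x~y x∈C → v⋆⇒C (C⇒v⋆ x∈C ◅◅ x~y ◅ ε)

  component-unique : ∀ {C D x} → IsComponent K C → IsComponent K D → x ∈ C → x ∈ D → C ≡ D
  component-unique (u , _ , C⇒u⋆ , u⋆⇒C) (v , _ , D⇒v⋆ , v⋆⇒D) x∈C x∈D = ⊆-antisym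
    (λ y∈C → v⋆⇒D (D⇒v⋆ x∈D ◅◅ star-sym (C⇒u⋆ x∈C) ◅◅ C⇒u⋆ y∈C))
    (λ y∈D → u⋆⇒C (C⇒u⋆ x∈C ◅◅ star-sym (D⇒v⋆ x∈D) ◅◅ D⇒v⋆ y∈D))

  component : Fin n → Subset n
  component v = tabulate λ u → does (star? v u)

  ∈-component⁺ : ∀ {u v} → Star _~_ v u → u ∈ component v
  ∈-component⁺ {u} {v} v⋆u = lookup⇒[]= u _
    (≡-trans (lookup∘tabulate _ u) (dec-true (star? v u) v⋆u))

  ∈-component⁻ : ∀ {u v} → u ∈ component v → Star _~_ v u
  ∈-component⁻ {u} {v} u∈ = does-true (star? v u)
    (≡-trans (sym (lookup∘tabulate _ u)) ([]=⇒lookup u∈))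
    where
    does-true : (p? : Dec P) → does p? ≡ true → P
    does-true (yes p) _ = p

  isComponent-component : ∀ {v} → v ∈ V K → IsComponent K (component v)
  isComponent-component {v} v∈V = v , v∈V , ∈-component⁻ , ∈-component⁺

  components : List (Subset n)
  components = filter (isComponent? K) (subsets n)

  unions-saturated : ∀ {Cs} → All (IsComponent K) Cs → ∀ {U} → U List.∈ unions Cs → Saturated U
  unions-saturated [] (here refl) = saturated-⊥
  unions-saturated {C ∷ Cs} (c ∷ cs) U∈ with ∈-++⁻ (unions Cs) U∈
  ... | inj₁ U∈′ = unions-saturated cs U∈′
  ... | inj₂ U∈′ with ∈-map⁻ (C △_) U∈′
  ...   | T , T∈ , refl = saturated-△ (saturated-component c) (unions-saturated cs T∈)

  -- A saturated `U` contains all of `C` or none of it, according to whether it contains the base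
  -- vertex `v`. If it does, `C △ U` is `U` with `C` removed, is covered by `Cs`, and gives back `U`
  -- when `C` is adjoined. If it does not, `U` is already covered by `Cs`.
  saturated⇒∈-unions : ∀ {Cs} → All (IsComponent K) Cs → ∀ {U} → Saturated U →
                       (∀ {x} → x ∈ U → Any (x ∈_) Cs) → U List.∈ unions Cs
  saturated⇒∈-unions [] sat covers =
    here (Empty-unique λ (x , x∈U) → contradiction (covers x∈U) λ ())
  saturated⇒∈-unions {C ∷ Cs} (c@(v , _ , C⇒v⋆ , v⋆⇒C) ∷ cs) {U} sat covers with v ∈? U
  ... | yes v∈U = ∈-++⁺ʳ (unions Cs)
    (subst (List._∈ map (C △_) (unions Cs)) (△-cancelˡ C U)
      (∈-map⁺ (C △_) (saturated⇒∈-unions cs (saturated-△ (saturated-component c) sat) covers′)))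
    where
    covers′ : ∀ {x} → x ∈ C △ U → Any (x ∈_) Cs
    covers′ x∈ with x∈S△T⁻ C U x∈
    ... | inj₁ (x∈C , x∉U) = contradiction (saturated-star sat (C⇒v⋆ x∈C) v∈U) x∉U
    ... | inj₂ (x∉C , x∈U) with covers x∈U
    ...   | here x∈C  = contradiction x∈C x∉C
    ...   | there x∈Cs = x∈Cs
  ... | no v∉U = ∈-++⁺ˡ (saturated⇒∈-unions cs sat covers′)
    where
    covers′ : ∀ {x} → x ∈ U → Any (x ∈_) Cs
    covers′ x∈U with covers x∈U
    ... | here x∈C   = contradiction (saturated-star sat (star-sym (C⇒v⋆ x∈C)) x∈U) v∉U
    ... | there x∈Cs = x∈Cs

  -- The base vertex `v` of `C` lies in no other component, so it tells the two halves of
  -- `unions (C ∷ Cs)` apart: no set in the first half contains it and every set in the second does.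
  unions-unique : ∀ {Cs} → All (IsComponent K) Cs → Unique Cs → Unique (unions Cs)
  unions-unique []       []          = [] ∷ []
  unions-unique {C ∷ Cs} (c@(v , _ , C⇒v⋆ , v⋆⇒C) ∷ cs) (C∉Cs ∷ Cs!) = Unique.++⁺
    (unions-unique cs Cs!)
    (Unique.map⁺ △-injective (unions-unique cs Cs!))
    λ (U∈ , U∈′) → disjoint U∈ (∈-map⁻ (C △_) U∈′)
    where
    △-injective : ∀ {S T} → C △ S ≡ C △ T → S ≡ T
    △-injective {S} {T} eq =
      ≡-trans (sym (△-cancelˡ C S)) (≡-trans (cong (C △_) eq) (△-cancelˡ C T))
    v∈C : v ∈ C
    v∈C = v⋆⇒C ε
    v∉Cs : All (v ∉_) Cs
    v∉Cs = All.zipWith (λ (C≢D , d) v∈D → C≢D (component-unique c d v∈C v∈D)) (C∉Cs , cs)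
    disjoint : ∀ {U} → U List.∈ unions Cs → ¬ (∃ λ T → T List.∈ unions Cs × U ≡ C △ T)
    disjoint U∈ (T , T∈ , refl) = ∉-unions v∉Cs U∈ (x∈S△T⁺ˡ v∈C (∉-unions v∉Cs T∈))

  all-components : All (IsComponent K) components
  all-components = all-filter (isComponent? K) (subsets n)

  -- Neither list has repetitions and their members agree, so they have the same multiplicities,
  -- which is what `∑-↭` needs. The components cover a saturated set since each of its vertices lies
  -- in its own component.
  saturated↭unions : filter saturated? (subsets n) ↭ unions components
  saturated↭unions = ∼bag⇒↭ (unique∧set⇒bag
    (Unique.filter⁺ saturated? (subsets-unique n))
    (unions-unique all-components (Unique.filter⁺ (isComponent? K) (subsets-unique n)))
    (mk⇔
      (λ U∈ → let sat = proj₂ (∈-filter⁻ saturated? {xs = subsets n} U∈) in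
        saturated⇒∈-unions all-components sat λ x∈U → List.lose
          (∈-filter⁺ (isComponent? K) (∈-subsets _) (isComponent-component (proj₁ sat x∈U)))
          (∈-component⁺ ε))
      (λ U∈ → ∈-filter⁺ saturated? (∈-subsets _) (unions-saturated all-components U∈))))

  ∑-saturated-sgn : ∑ (subsets n) (λ U → χ (saturated? U) * sgn U) ≡
                    χ (conformal? K) * + (2 ^ k K)
  ∑-saturated-sgn = begin
    ∑ (subsets n) (λ U → χ (saturated? U) * sgn U)
      ≡⟨ ∑-filter saturated? (subsets n) sgn ⟨
    ∑ (filter saturated? (subsets n)) sgn
      ≡⟨ ∑-↭ sgn saturated↭unions ⟩
    ∑ (unions components) sgn
      ≡⟨ ∑-unions-sgn components ⟩
    χ evens? * + (2 ^ k K)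
      ≡⟨ cong (_* + (2 ^ k K)) (χ-cong
           (λ evens C c → All.lookup evens (∈-filter⁺ (isComponent? K) (∈-subsets C) c))
           (λ conf → All.map (conf _) all-components)
           evens? (conformal? K)) ⟩
    χ (conformal? K) * + (2 ^ k K) ∎
    where
    open ≡-Reasoning
    evens? = All.all? (λ C → 2 ∣? ∣ C ∣) components

-- From dominating sets to saturated sets of induced subgraphs.

module _ (G : Graph n) where
  open Graph G using (_~_; ~-sym; ~⇒∈V)
  open Components using (Saturated; saturated?; ∑-saturated-sgn)

  -- Since closed neighborhoods contain their centers, `Within (Undominated W) U` says that `U` is a
  -- set of vertices of `G` disjoint from `W` with no edge to `W`.
  Undominated : Subset n → Fin n → Set
  Undominated W x = x ∈ V G × ¬ N[_]ₛ G W x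

  undominated? : ∀ W x → Dec (Undominated W x)
  undominated? W x = (x ∈? V G) ×-dec ¬? (N[_]ₛ? G W x)

  -- `W` dominates exactly when no vertex is undominated, and `∑-within-sgn` detects this. As
  -- `Dominating` is an equality of sets, `W ⊆ V G` supplies the inclusion of the closed
  -- neighborhood in `V G`. The factor `1ℤ` matches the summand produced by `∑-filter`.
  χ-dominating : ∀ {W} → W ⊆ V G → χ (dominating? G W) * 1ℤ ≡
                 ∑ (subsets n) (λ U → χ (within? (undominated? W) U) * sgn U)
  χ-dominating {W} W⊆V = begin
    χ (dominating? G W) * 1ℤ
      ≡⟨ *-identityʳ _ ⟩
    χ (dominating? G W)
      ≡⟨ χ-cong {P = Dominating G W}
           (λ (_ , V⊆N) x (x∈V , x∉N) → x∉N (V⊆N x∈V))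
           (λ none → N⊆V , λ {x} x∈V →
             decidable-stable (N[_]ₛ? G W x) λ x∉N → none x (x∈V , x∉N))
           (dominating? G W) (all? (¬? ∘ undominated? W)) ⟩
    χ (all? (¬? ∘ undominated? W))
      ≡⟨ ∑-within-sgn (undominated? W) ⟨
    ∑ (subsets n) (λ U → χ (within? (undominated? W) U) * sgn U) ∎
    where
    open ≡-Reasoning
    N⊆V : ∀ {x} → N[_]ₛ G W x → x ∈ V G
    N⊆V (v , v∈W , inj₁ refl) = W⊆V v∈W
    N⊆V (v , v∈W , inj₂ v~x)  = ~⇒∈V (~-sym v~x)

  -- Here `H △ U` plays the role of `W`. A vertex of `U` outside `H` would lie in `W` and dominate
  -- itself, so `U ⊆ H`. A neighbor in `H` of a vertex of `U`, if not in `U`, would lie in `W` and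
  -- dominate that vertex.
  separated⇒saturated : ∀ H U → H △ U ⊆ V G × Within (Undominated (H △ U)) U →
                        H ⊆ V G × Saturated (G [ H ]) U
  separated⇒saturated H U (△⊆V , sep) = H⊆V , (λ x∈U → x∈p∩q⁺ (U⊆V x∈U , U⊆H x∈U)) , closed
    where
    U⊆V : U ⊆ V G
    U⊆V x∈U = proj₁ (sep _ x∈U)
    U⊆H : U ⊆ H
    U⊆H {x} x∈U = decidable-stable (x ∈? H) λ x∉H →
      proj₂ (sep x x∈U) (x , x∈S△T⁺ʳ x∉H x∈U , inj₁ refl)
    H⊆V : H ⊆ V G
    H⊆V {x} x∈H with x ∈? U
    ... | yes x∈U = U⊆V x∈U
    ... | no  x∉U = △⊆V (x∈S△T⁺ˡ x∈H x∉U)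
    closed : ∀ x y → (x ~ y × x ∈ H × y ∈ H) → x ∈ U → y ∈ U
    closed x y (x~y , _ , y∈H) x∈U = decidable-stable (y ∈? U) λ y∉U →
      proj₂ (sep x x∈U) (y , x∈S△T⁺ˡ y∈H y∉U , inj₂ (~-sym x~y))

  -- Since `U ⊆ H`, the set `H △ U` consists of the elements of `H` outside `U`. If one of them
  -- dominated some `x ∈ U`, it would be `x` itself or a neighbor of `x` in `H`, which closedness
  -- would place in `U`.
  saturated⇒separated : ∀ H U → H ⊆ V G × Saturated (G [ H ]) U →
                        H △ U ⊆ V G × Within (Undominated (H △ U)) U
  saturated⇒separated H U (H⊆V , U⊆ , closed) = (λ x∈ → H⊆V (proj₁ (△⊆H∖U x∈))) , λ x x∈U →
    p∩q⊆p (V G) H (U⊆ x∈U) , λ where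
      (_ , w∈ , inj₁ refl) → proj₂ (△⊆H∖U w∈) x∈U
      (w , w∈ , inj₂ w~x)  → let w∈H , w∉U = △⊆H∖U w∈ in
        w∉U (closed x w (~-sym w~x , U⊆H x∈U , w∈H) x∈U)
    where
    U⊆H : U ⊆ H
    U⊆H x∈U = p∩q⊆q (V G) H (U⊆ x∈U)
    △⊆H∖U : ∀ {x} → x ∈ H △ U → x ∈ H × x ∉ U
    △⊆H∖U x∈ with x∈S△T⁻ H U x∈
    ... | inj₁ x∈H∖U       = x∈H∖U
    ... | inj₂ (x∉H , x∈U) = contradiction (U⊆H x∈U) x∉H

  -- Both counts as double sums of signs.

  pos-d : + d G ≡ ∑ (subsets n) (λ W → χ (W ⊆? V G) *
                    ∑ (subsets n) (λ U → χ (within? (undominated? W) U) * sgn U))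
  pos-d = begin
    + d G
      ≡⟨ pos-length (filter (dominating? G) (subsetsOf (V G))) ⟩
    ∑ (filter (dominating? G) (subsetsOf (V G))) (λ _ → 1ℤ)
      ≡⟨ ∑-filter (dominating? G) (subsetsOf (V G)) _ ⟩
    ∑ (subsetsOf (V G)) (λ W → χ (dominating? G W) * 1ℤ)
      ≡⟨ ∑-filter (_⊆? V G) (subsets n) _ ⟩
    ∑ (subsets n) (λ W → χ (W ⊆? V G) * (χ (dominating? G W) * 1ℤ))
      ≡⟨ ∑-cong (subsets n) (λ W → χ-*-congˡ (W ⊆? V G) (χ-dominating {W})) ⟩
    ∑ (subsets n) (λ W → χ (W ⊆? V G) *
      ∑ (subsets n) (λ U → χ (within? (undominated? W) U) * sgn U)) ∎
    where open ≡-Reasoning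

  pos-∑-Con : + sum (map (λ H → 2 ^ k H) (Con G)) ≡
              ∑ (subsets n) (λ H → χ (H ⊆? V G) *
                ∑ (subsets n) (λ U → χ (saturated? (G [ H ]) U) * sgn U))
  pos-∑-Con = begin
    + sum (map (λ H → 2 ^ k H) (Con G))
      ≡⟨ pos-sum (λ H → 2 ^ k H) (Con G) ⟩
    ∑ (Con G) (λ H → + (2 ^ k H))
      ≡⟨ ∑-filter conformal? (map (G [_]) (subsetsOf (V G))) _ ⟩
    ∑ (map (G [_]) (subsetsOf (V G))) (λ H → χ (conformal? H) * + (2 ^ k H))
      ≡⟨ ∑-map (G [_]) (subsetsOf (V G)) _ ⟩
    ∑ (subsetsOf (V G)) (λ H → χ (conformal? (G [ H ])) * + (2 ^ k (G [ H ])))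
      ≡⟨ ∑-filter (_⊆? V G) (subsets n) _ ⟩
    ∑ (subsets n) (λ H → χ (H ⊆? V G) * (χ (conformal? (G [ H ])) * + (2 ^ k (G [ H ]))))
      ≡⟨ ∑-cong (subsets n) (λ H → cong (χ (H ⊆? V G) *_) (∑-saturated-sgn (G [ H ]))) ⟨
    ∑ (subsets n) (λ H → χ (H ⊆? V G) *
      ∑ (subsets n) (λ U → χ (saturated? (G [ H ]) U) * sgn U)) ∎
    where open ≡-Reasoning

theorem13 : ∀ {n : ℕ} (G : Graph n) → d G ≡ sum (map (λ H → 2 ^ k H) (Con G))
theorem13 {n} G = +-injective (begin
  + d G
    ≡⟨ pos-d G ⟩
  ∑ (subsets n) (λ W → χ (W ⊆? V G) *
    ∑ (subsets n) (λ U → χ (within? (undominated? G W) U) * sgn U))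
    ≡⟨ ∑-cong (subsets n) (λ W → χ-*-∑ (W ⊆? V G) (within? (undominated? G W)) (subsets n) sgn) ⟩
  ∑ (subsets n) (λ W → ∑ (subsets n) (λ U → χ (separated? W U) * sgn U))
    -- The substitution `W = H △ U` is a bijection only for fixed `U`, so `U` is made the outer
    -- variable first; a second exchange then puts `H` outside.
    ≡⟨ ∑-swap (subsets n) (subsets n) _ ⟩
  ∑ (subsets n) (λ U → ∑ (subsets n) (λ W → χ (separated? W U) * sgn U))
    ≡⟨ ∑-cong (subsets n) (λ U → ∑-△ U (λ W → χ (separated? W U) * sgn U)) ⟨
  ∑ (subsets n) (λ U → ∑ (subsets n) (λ H → χ (separated? (H △ U) U) * sgn U))
    ≡⟨ ∑-swap (subsets n) (subsets n) _ ⟩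
  ∑ (subsets n) (λ H → ∑ (subsets n) (λ U → χ (separated? (H △ U) U) * sgn U))
    ≡⟨ ∑-cong (subsets n) (λ H → ∑-cong (subsets n) λ U → cong (_* sgn U) (χ-cong
         (separated⇒saturated G H U) (saturated⇒separated G H U)
         (separated? (H △ U) U) ((H ⊆? V G) ×-dec saturated? (G [ H ]) U))) ⟩
  ∑ (subsets n) (λ H →
    ∑ (subsets n) (λ U → χ ((H ⊆? V G) ×-dec saturated? (G [ H ]) U) * sgn U))
    ≡⟨ ∑-cong (subsets n) (λ H → χ-*-∑ (H ⊆? V G) (saturated? (G [ H ])) (subsets n) sgn) ⟨
  ∑ (subsets n) (λ H → χ (H ⊆? V G) *
    ∑ (subsets n) (λ U → χ (saturated? (G [ H ]) U) * sgn U))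
    ≡⟨ pos-∑-Con G ⟨
  + sum (map (λ H → 2 ^ k H) (Con G)) ∎)
  where
  open ≡-Reasoning
  open Components using (saturated?)
  separated? : ∀ W U → Dec (W ⊆ V G × Within (Undominated G W) U)
  separated? W U = (W ⊆? V G) ×-dec within? (undominated? G W) U
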